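{- If $n\geq 1$ and $k\geq 1$, then the Munarini graph $M_{n,k}$ is a daisy cube. Furthermore, for $k\geq 2$, the map $\widehat{\Psi}$ is a proper embedding of $M_{n,k}$ in $Q_{kn}$, and $\Gamma_{n,k}^\star$ is the daisy cube generated by $$X=\{\widehat{\Psi}(u)\mid u\in \mathcal{A}_{n,k}\}.$$ The maximal vertices of this daisy cube are exactly the strings of $X$, that is, the images by $\widehat{\Psi}$ of the vertices of $M_{n,k}$ that contain no $0$.
   Context: For integers $k\geq 1$, $n\geq 0$, a $k$-generalized Pell string of length $n$ is a word of length $n$ over the alphabet $\{0,1,\ldots,k\}$ in which every maximal run of the character $k$ has even length; equivalently, it is a (necessarily unique) concatenation of letters from $\{0,1,\ldots,k-1,kk\}$. Let $\mathcal{F}_{n,k}$ be the set of these strings, and let $\mathcal{A}_{n,k}$ be the set of strings in $\mathcal{F}_{n,k}$ containing no character $0$. The Munarini graph $M_{n,k}$ is the simple graph with vertex set $\mathcal{F}_{n,k}$ in which two vertices are adjacent if one of them can be obtained from the other either by replacing one occurrence of $0$ with some $i\in\{1,\ldots,k-1\}$, or by replacing one substring $00$ (two consecutive positions) with $kk$ (both replacements may be read in either direction, and both strings must be in $\mathcal{F}_{n,k}$). $Q_m$ is the hypercube with vertex set $B^m=\{0,1\}^m$, two strings being adjacent iff they differ in exactly one coordinate; its graph distance is the Hamming distance. Let $A_0=0^k$ and $A_i=0^{i-1}10^{k-i}$ for $i\in\{1,\ldots,k\}$ (binary strings of length $k$). Let $\mathcal{F}_{n,k}^\star$ be the set of binary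 strings of length $kn$ that are concatenations of strings from $\{A_0,A_1,\ldots,A_{k-1},A_kA_0\}$, and let $\Gamma_{n,k}^\star$ be the subgraph of $Q_{kn}$ induced by $\mathcal{F}_{n,k}^\star$. The map $\widehat{\Psi}:\mathcal{F}_{n,k}\to\mathcal{F}_{n,k}^\star$ is obtained by writing $u\in\mathcal{F}_{n,k}$ as a concatenation of letters from $\{0,\ldots,k-1,kk\}$ and replacing each letter $i\in\{0,\ldots,k-1\}$ by $A_i$ and each letter $kk$ by $A_kA_0$. Order $B^m$ coordinatewise: $u\leq v$ iff $u_i\leq v_i$ for all $i$. For $X\subseteq B^m$, the daisy cube generated by $X$ is the subgraph $Q_m(X)$ of $Q_m$ induced by $\{u\in B^m\mid u\leq x \text{ for some } x\in X\}$. The maximal vertices of $Q_m(X)$ are the maximal elements of the poset $(X,\leq)$ (equivalently of $(V(Q_m(X)),\leq)$). A graph $G$ is a daisy cube if there is an isometric embedding of $G$ in some $Q_m$ (a map $V(G)\to B^m$ such that graph distances in $G$ equal Hamming distances of the images) and a subset $X\subseteq B^m$ such that the image of $G$ is the daisy cube $Q_m(X)$; such an embedding is called a proper embedding. -}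

module Defs where

open import Data.Bool.Base as Bool using (Bool; true; false; _xor_)
import Data.Bool.Properties as Bool
open import Data.Fin.Base using (Fin; zero; suc; toℕ; fromℕ; inject₁)
open import Data.Fin.Properties using (fromℕ≢inject₁; inject₁-injective)
open import Data.Fin.Relation.Unary.Top using (view; ‵fromℕ; ‵inject₁)
open import Data.Irrelevant using ([_])
open import Data.List.Base as List using ([]; _∷_; _++_)
open import Data.Maybe.Base using (just)
open import Data.Maybe.Properties using (just-injective)
open import Data.Nat.Base using (ℕ; zero; suc; _+_; _*_; _≤_; _<_; s≤s; NonZero)
open import Data.Nat.Divisibility using (_∣_; ∣m+n∣m⇒∣n; ∣-refl; ∣1⇒≡1)
open import Data.Product.Base using (∃-syntax; Σ; _×_; _,_; proj₁; proj₂)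
open import Data.Refinement.Base using (Refinement-syntax; value; _,_)
open import Data.Vec.Base as Vec using (Vec; []; _∷_; toList)
open import Data.Vec.Membership.Propositional using (_∉_)
import Data.Vec.Properties as Vec
open import Data.Vec.Relation.Binary.Pointwise.Inductive as Pointwise using (Pointwise)
open import Level using (0ℓ)
open import Relation.Binary.Construct.Closure.Symmetric as Sym using (SymClosure; fwd; bwd)
open import Relation.Binary.Core using (Rel; _⇔_)
open import Relation.Binary.Definitions using (Symmetric)
open import Relation.Binary.PropositionalEquality using (_≡_; _≢_; refl; sym; trans; cong; cong₂; subst)
open import Relation.Nullary using (¬_; Dec; yes; no; contradiction; recompute)
open import Relation.Unary using (Pred; _≐_)

private
  variable
    k m n : ℕ

record Graph : Set₁ where
  field
    Vertex : Set
    Adj    : Rel Vertex 0ℓ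
    symm   : Symmetric Adj
    irrefl : ∀ {v} → ¬ Adj v v

open Graph

data Walk (G : Graph) : ℕ → Vertex G → Vertex G → Set where
  stop : ∀ {u} → Walk G 0 u u
  step : ∀ {l u v w} → Adj G u v → Walk G l v w → Walk G (suc l) u w

-- Graph distance as a relation, so that connectedness is not presupposed.
Distance : (G : Graph) → Vertex G → Vertex G → ℕ → Set
Distance G u v d = Walk G d u v × (∀ l → Walk G l u v → d ≤ l)

record Subgraph (G : Graph) : Set₁ where
  field
    V     : Pred (Vertex G) 0ℓ
    E     : Rel (Vertex G) 0ℓ
    E-sym : Symmetric E
    E⊆V   : ∀ {u v} → E u v → V u × V v
    E⊆Adj : ∀ {u v} → E u v → Adj G u v

open Subgraph

infix 4 _≈ₛ_
_≈ₛ_ : {G : Graph} → Subgraph G → Subgraph G → Set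
H ≈ₛ K = (V H ≐ V K) × (E H ⇔ E K)

induced : (G : Graph) → Pred (Vertex G) 0ℓ → Subgraph G
induced G P = record
  { V     = P
  ; E     = λ u v → P u × P v × Adj G u v
  ; E-sym = λ (p , q , a) → q , p , symm G a
  ; E⊆V   = λ (p , q , _) → p , q
  ; E⊆Adj = λ (_ , _ , a) → a
  }

B : ℕ → Set
B m = Vec Bool m

hamming : B m → B m → ℕ
hamming u v = Vec.count (Bool._≟ true) (Vec.zipWith _xor_ u v)

hamming-sym : (u v : B m) → hamming u v ≡ hamming v u
hamming-sym u v =
  cong (Vec.count (Bool._≟ true)) (Vec.zipWith-comm Bool.xor-comm u v)

hamming-refl : (u : B m) → hamming u u ≡ 0
hamming-refl []          = refl
hamming-refl (true  ∷ u) = hamming-refl u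
hamming-refl (false ∷ u) = hamming-refl u

Q : ℕ → Graph
Q m = record
  { Vertex = B m
  ; Adj    = λ u v → hamming u v ≡ 1
  ; symm   = λ {u} {v} e → trans (hamming-sym v u) e
  ; irrefl = λ {v} e → contradiction (trans (sym (hamming-refl v)) e) λ ()
  }

infix 4 _≤ᴮ_
_≤ᴮ_ : Rel (B m) 0ℓ
_≤ᴮ_ = Pointwise Bool._≤_

≤ᴮ-refl : {u : B m} → u ≤ᴮ u
≤ᴮ-refl = Pointwise.refl Bool.≤-refl

≤ᴮ-trans : {u v w : B m} → u ≤ᴮ v → v ≤ᴮ w → u ≤ᴮ w
≤ᴮ-trans = Pointwise.trans Bool.≤-trans

≤ᴮ-antisym : {u v : B m} → u ≤ᴮ v → v ≤ᴮ u → u ≡ v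
≤ᴮ-antisym Pointwise.[]         Pointwise.[]         = refl
≤ᴮ-antisym (p Pointwise.∷ ps) (q Pointwise.∷ qs) =
  cong₂ _∷_ (Bool.≤-antisym p q) (≤ᴮ-antisym ps qs)

daisyCube : Pred (B m) 0ℓ → Subgraph (Q m)
daisyCube {m} X = induced (Q m) (λ u → ∃[ x ] X x × u ≤ᴮ x)

Maximal : Pred (B m) 0ℓ → Pred (B m) 0ℓ
Maximal P x = P x × (∀ {y} → P y → x ≤ᴮ y → y ≡ x)

-- For the daisy cube generated by X, the maximal elements of the poset (X,≤).
MaximalVertex : Pred (B m) 0ℓ → Pred (B m) 0ℓ
MaximalVertex X = Maximal X

-- The maximal vertices depend only on the graph, not on the generating set.
maximalVertex-intrinsic : (X : Pred (B m) 0ℓ) →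
                          MaximalVertex X ≐ Maximal (V (daisyCube X))
maximalVertex-intrinsic X = to , from
  where
  to : ∀ {x} → Maximal X x → Maximal (V (daisyCube X)) x
  to {x} (Xx , max) = (x , Xx , ≤ᴮ-refl) , λ {y} (z , Xz , y≤z) x≤y →
    let z≡x = max Xz (≤ᴮ-trans x≤y y≤z)
    in ≤ᴮ-antisym (subst (y ≤ᴮ_) z≡x y≤z) x≤y
  from : ∀ {x} → Maximal (V (daisyCube X)) x → Maximal X x
  from ((z , Xz , x≤z) , max) =
    subst X (max (z , Xz , ≤ᴮ-refl) x≤z) Xz ,
    λ {y} Xy → max (y , Xy , ≤ᴮ-refl)

IsIsometric : (G : Graph) (m : ℕ) → (Vertex G → B m) → Set
IsIsometric G m f = ∀ u v → Distance G u v (hamming (f u) (f v))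

isometric⇒adj : ∀ {G m f} → IsIsometric G m f →
                ∀ {u v} → Adj G u v → hamming (f u) (f v) ≡ 1
isometric⇒adj {G} {f = f} iso {u} {v} a = go (proj₁ (iso u v)) (proj₂ (iso u v) 1 (step a stop))
  where
  go : ∀ {d} → Walk G d u v → d ≤ 1 → d ≡ 1
  go stop                 _        = contradiction a (irrefl G)
  go (step _ stop)        _        = refl
  go (step _ (step _ _)) (s≤s ())

image : ∀ {G m f} → IsIsometric G m f → Subgraph (Q m)
image {G} {m} {f} iso = record
  { V     = λ x → ∃[ u ] f u ≡ x
  ; E     = λ x y → ∃[ u ] ∃[ v ] Adj G u v × f u ≡ x × f v ≡ y
  ; E-sym = λ (u , v , a , p , q) → v , u , symm G a , q , p
  ; E⊆V   = λ (u , v , _ , p , q) → (u , p) , (v , q)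
  ; E⊆Adj = λ { (u , v , a , refl , refl) → isometric⇒adj {G} {m} {f} iso a }
  }

IsProperEmbedding : (G : Graph) (m : ℕ) → (Vertex G → B m) → Set₁
IsProperEmbedding G m f =
  Σ (IsIsometric G m f) λ iso →
    ∃[ X ] image {G} {m} {f} iso ≈ₛ daisyCube X

IsDaisyCube : Graph → Set₁
IsDaisyCube G = ∃[ m ] ∃[ f ] IsProperEmbedding G m f

-- Words over {0,…,k}; the character k is fromℕ k.
Word : ℕ → ℕ → Set
Word k n = Vec (Fin (suc k)) n

-- In a factorization w = xs·kˡ·ys where xs does not end and ys does not
-- start with k, the middle factor is a maximal run (or empty).
IsPell : Pred (Word k n) 0ℓ
IsPell {k} w = ∀ xs l ys →
  toList w ≡ xs ++ List.replicate l (fromℕ k) ++ ys →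
  List.last xs ≢ just (fromℕ k) →
  List.head ys ≢ just (fromℕ k) →
  2 ∣ l

-- A refinement type: equality of Pell strings is equality of words.
Pell : ℕ → ℕ → Set
Pell n k = [ w ∈ Word k n ∣ IsPell w ]

NoZero : Pred (Pell n k) 0ℓ
NoZero u = zero ∉ value u

-- Concatenations, of total length n, of letters from {0,…,k-1,kk}.
data Letters (k : ℕ) : ℕ → Set where
  []   : Letters k 0
  char : Fin k → Letters k n → Letters k (suc n)
  kk   : Letters k n → Letters k (suc (suc n))

spell : Letters k n → Word k n
spell     []          = []
spell     (char i ls) = inject₁ i ∷ spell ls
spell {k} (kk ls)     = fromℕ k ∷ fromℕ k ∷ spell ls

spell-injective : (ls ls′ : Letters k n) → spell ls ≡ spell ls′ → ls ≡ ls′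
spell-injective []          []            _  = refl
spell-injective (char i ls) (char j ls′) eq =
  cong₂ char (inject₁-injective (Vec.∷-injectiveˡ eq))
             (spell-injective ls ls′ (Vec.∷-injectiveʳ eq))
spell-injective (char i ls) (kk ls′)     eq =
  contradiction (sym (Vec.∷-injectiveˡ eq)) fromℕ≢inject₁
spell-injective (kk ls)     (char j ls′) eq =
  contradiction (Vec.∷-injectiveˡ eq) fromℕ≢inject₁
spell-injective (kk ls)     (kk ls′)     eq =
  cong kk (spell-injective ls ls′ (Vec.∷-injectiveʳ (Vec.∷-injectiveʳ eq)))

letters? : (w : Word k n) → Dec (∃[ ls ] spell ls ≡ w)
letters? []      = yes ([] , refl)
letters? (a ∷ w) with view a
letters? (_ ∷ w) | ‵inject₁ i with letters? w
... | yes (ls , refl) = yes (char i ls , refl)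
... | no ¬ls = no λ where
  (char j ls , eq) → ¬ls (ls , Vec.∷-injectiveʳ eq)
  (kk ls     , eq) → fromℕ≢inject₁ (Vec.∷-injectiveˡ eq)
letters? (_ ∷ []) | ‵fromℕ = no λ where
  (char j ls , eq) → fromℕ≢inject₁ (sym (Vec.∷-injectiveˡ eq))
letters? (_ ∷ b ∷ w) | ‵fromℕ with view b
... | ‵inject₁ i = no λ where
  (char j ls , eq) → fromℕ≢inject₁ (sym (Vec.∷-injectiveˡ eq))
  (kk ls     , eq) → fromℕ≢inject₁ (Vec.∷-injectiveˡ (Vec.∷-injectiveʳ eq))
... | ‵fromℕ with letters? w
...   | yes (ls , refl) = yes (kk ls , refl)
...   | no ¬ls = no λ where
  (char j ls , eq) → fromℕ≢inject₁ (sym (Vec.∷-injectiveˡ eq))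
  (kk ls     , eq) → ¬ls (ls , Vec.∷-injectiveʳ (Vec.∷-injectiveʳ eq))

pell⇒letters : (w : Word k n) → IsPell w → ∃[ ls ] spell ls ≡ w
pell⇒letters []      p = [] , refl
pell⇒letters (a ∷ w) p with view a
pell⇒letters {k} (_ ∷ w) p | ‵inject₁ i =
  let ls , eq = pell⇒letters w p′ in char i ls , cong (inject₁ i ∷_) eq
  where
  p′ : IsPell w
  p′ []       l ys eq _  = p (inject₁ i ∷ []) l ys (cong (inject₁ i ∷_) eq)
                             (λ e → fromℕ≢inject₁ (sym (just-injective e)))
  p′ (x ∷ xs) l ys eq = p (inject₁ i ∷ x ∷ xs) l ys (cong (inject₁ i ∷_) eq)
pell⇒letters (_ ∷ []) p | ‵fromℕ =
  contradiction (∣1⇒≡1 (p [] 1 [] refl (λ ()) (λ ()))) λ ()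
pell⇒letters {k} (_ ∷ b ∷ w) p | ‵fromℕ with view b
... | ‵inject₁ i =
  contradiction (∣1⇒≡1 (p [] 1 (inject₁ i ∷ toList w) refl (λ ())
                          (λ e → fromℕ≢inject₁ (sym (just-injective e))))) λ ()
... | ‵fromℕ =
  let ls , eq = pell⇒letters w p′ in kk ls , cong (λ v → fromℕ k ∷ fromℕ k ∷ v) eq
  where
  p′ : IsPell w
  p′ []       l ys eq _ h = ∣m+n∣m⇒∣n
    (p [] (2 + l) ys (cong (λ v → fromℕ k ∷ fromℕ k ∷ v) eq) (λ ()) h) ∣-refl
  p′ (x ∷ xs) l ys eq = p (fromℕ k ∷ fromℕ k ∷ x ∷ xs) l ys
    (cong (λ v → fromℕ k ∷ fromℕ k ∷ v) eq)

-- Unique by spell-injective; IsPell enters only to rule out failure.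
decompose : (u : Pell n k) → ∃[ ls ] spell ls ≡ value u
decompose (w , [ p ]) = recompute (letters? w) (pell⇒letters w p)

infix 4 _⟶_
data _⟶_ {k : ℕ} : Word k n → Word k n → Set where
  0↦i   : {w : Word k n} (i : Fin (suc k)) → 1 ≤ toℕ i → toℕ i < k →
          zero ∷ w ⟶ i ∷ w
  00↦kk : {w : Word k n} →
          zero ∷ zero ∷ w ⟶ fromℕ k ∷ fromℕ k ∷ w
  there : {v w : Word k n} (a : Fin (suc k)) → v ⟶ w →
          a ∷ v ⟶ a ∷ w

⟶-irrefl : .{{_ : NonZero k}} {v w : Word k n} → v ⟶ w → v ≢ w
⟶-irrefl         (0↦i zero () _) refl
⟶-irrefl {suc k} 00↦kk           ()
⟶-irrefl         (there a r)     eq = ⟶-irrefl r (Vec.∷-injectiveʳ eq)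

M : (n k : ℕ) .{{_ : NonZero k}} → Graph
M n k = record
  { Vertex = Pell n k
  ; Adj    = λ u v → SymClosure _⟶_ (value u) (value v)
  ; symm   = Sym.symmetric _⟶_
  ; irrefl = λ where
      (fwd r) → ⟶-irrefl r refl
      (bwd r) → ⟶-irrefl r refl
  }

-- A₀ = 0ᵏ and Aᵢ = 0ⁱ⁻¹10ᵏ⁻ⁱ; vector positions count from 0, so the 1 of
-- A_{i+1} is at position i.
A : Fin (suc k) → B k
A {k} zero    = Vec.replicate k false
A {k} (suc i) = Vec.replicate k false Vec.[ i ]≔ true

-- Concatenations of strings from {A₀,…,A_{k-1},A_kA₀}, with n blocks in total.
data FStar (k : ℕ) : (n : ℕ) → B (n * k) → Set where
  []  : FStar k 0 []
  A∷  : (i : Fin k) {w : B (n * k)} → FStar k n w →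
        FStar k (suc n) (A (inject₁ i) Vec.++ w)
  AA∷ : {w : B (n * k)} → FStar k n w →
        FStar k (suc (suc n)) (A (fromℕ k) Vec.++ A zero Vec.++ w)

Γ⋆ : (n k : ℕ) → Subgraph (Q (n * k))
Γ⋆ n k = induced (Q (n * k)) (FStar k n)

encode : Letters k n → B (n * k)
encode     []          = []
encode     (char i ls) = A (inject₁ i) Vec.++ encode ls
encode {k} (kk ls)     = A (fromℕ k) Vec.++ A zero Vec.++ encode ls

encode-FStar : (ls : Letters k n) → FStar k n (encode ls)
encode-FStar []          = []
encode-FStar (char i ls) = A∷ i (encode-FStar ls)
encode-FStar (kk ls)     = AA∷ (encode-FStar ls)

Ψ̂ : (n k : ℕ) → Pell n k → [ w ∈ B (n * k) ∣ FStar k n w ]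
Ψ̂ n k u = let ls , _ = decompose u in encode ls , [ encode-FStar ls ]

X : (n k : ℕ) → Pred (B (n * k)) 0ℓ
X n k w = ∃[ u ] NoZero u × value (Ψ̂ n k u) ≡ w

{-# OPTIONS --safe #-}
-- Ψ̂ is an injection whose image is closed downwards, and it identifies the
-- edges of M n k with the pairs at Hamming distance 1: both 0 ↦ i and 00 ↦ kk
-- turn a single bit on.  Any such map is a proper embedding, because two
-- points x, y of a down-closed set are joined inside it by a walk of length
-- hamming x y that first turns off the bits of x ∖ y.  Since a point below Aᵢ
-- is A₀ or Aᵢ, the maximal images are those without a letter 0, which can be
-- replaced by 1 when k ≥ 2.
module Submission where

open import Defs
open import Data.Bool.Base using (true; false; f≤t; b≤b)
open import Data.Fin.Base using (Fin; zero; suc; toℕ; fromℕ; inject₁)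
open import Data.Fin.Properties using (fromℕ≢inject₁; inject₁-injective; inject₁ℕ<; toℕ-fromℕ)
open import Data.Irrelevant using ([_])
import Data.List.Base as List
import Data.List.Properties as List
open import Data.Maybe.Base using (just)
open import Data.Nat.Base using (ℕ; zero; suc; _+_; _≤_; _*_; z≤n; s≤s; NonZero)
open import Data.Nat.Divisibility using (_∣0; ∣m∣n⇒∣m+n; ∣-refl)
open import Data.Nat.Properties using (≤-refl; ≤-trans; ≤-reflexive; +-monoʳ-≤; +-identityʳ; +-suc; m≤n⇒m≤1+n; <-irrefl; m+n≡0⇒m≡0; suc-injective; module ≤-Reasoning)
open import Data.Product.Base using (Σ-syntax; ∃-syntax; _×_; _,_; proj₁; proj₂)
open import Data.Refinement.Base using (value; _,_)
open import Data.Refinement.Properties using (value-injective)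
open import Data.Sum.Base using (_⊎_; inj₁; inj₂)
open import Data.Vec.Base as Vec using ([]; _∷_; _++_)
open import Data.Vec.Membership.Propositional using (_∉_)
open import Data.Vec.Properties using (∷-injectiveˡ; ∷-injectiveʳ; ++-injective; ++-injectiveˡ; ++-injectiveʳ)
open import Data.Vec.Relation.Binary.Pointwise.Inductive using ([]; _∷_; ++⁺; ++ˡ⁻; ++ʳ⁻)
open import Data.Vec.Relation.Unary.Any using (here; there)
open import Function.Base using (_∘_; id)
open import Relation.Binary.Construct.Closure.Symmetric as Sym using (SymClosure; fwd; bwd)
open import Relation.Binary.PropositionalEquality using (_≡_; _≢_; refl; sym; trans; cong; cong₂; subst; subst₂)
open import Relation.Nullary using (contradiction)
open import Relation.Unary using (_≐_)

open Graph

private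
  variable
    k m n : ℕ

-- Hamming distance: triangle inequality and concatenation.

hamming≡0⇒≡ : (u v : B m) → hamming u v ≡ 0 → u ≡ v
hamming≡0⇒≡ []          []          _ = refl
hamming≡0⇒≡ (true  ∷ u) (true  ∷ v) e = cong (true ∷_) (hamming≡0⇒≡ u v e)
hamming≡0⇒≡ (false ∷ u) (false ∷ v) e = cong (false ∷_) (hamming≡0⇒≡ u v e)

hamming-triangle : (u v w : B m) → hamming u w ≤ hamming u v + hamming v w
hamming-triangle []          []          []          = z≤n
hamming-triangle (true  ∷ u) (true  ∷ v) (true  ∷ w) = hamming-triangle u v w
hamming-triangle (true  ∷ u) (true  ∷ v) (false ∷ w) =
  ≤-trans (s≤s (hamming-triangle u v w)) (≤-reflexive (sym (+-suc _ _)))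
hamming-triangle (true  ∷ u) (false ∷ v) (true  ∷ w) =
  ≤-trans (hamming-triangle u v w) (m≤n⇒m≤1+n (+-monoʳ-≤ (hamming u v) (m≤n⇒m≤1+n ≤-refl)))
hamming-triangle (true  ∷ u) (false ∷ v) (false ∷ w) = s≤s (hamming-triangle u v w)
hamming-triangle (false ∷ u) (true  ∷ v) (true  ∷ w) = s≤s (hamming-triangle u v w)
hamming-triangle (false ∷ u) (true  ∷ v) (false ∷ w) =
  ≤-trans (hamming-triangle u v w) (m≤n⇒m≤1+n (+-monoʳ-≤ (hamming u v) (m≤n⇒m≤1+n ≤-refl)))
hamming-triangle (false ∷ u) (false ∷ v) (true  ∷ w) =
  ≤-trans (s≤s (hamming-triangle u v w)) (≤-reflexive (sym (+-suc _ _)))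
hamming-triangle (false ∷ u) (false ∷ v) (false ∷ w) = hamming-triangle u v w

hamming-++ : (a b : B m) (u v : B n) →
             hamming (a ++ u) (b ++ v) ≡ hamming a b + hamming u v
hamming-++ []          []          u v = refl
hamming-++ (true  ∷ a) (true  ∷ b) u v = hamming-++ a b u v
hamming-++ (true  ∷ a) (false ∷ b) u v = cong suc (hamming-++ a b u v)
hamming-++ (false ∷ a) (true  ∷ b) u v = cong suc (hamming-++ a b u v)
hamming-++ (false ∷ a) (false ∷ b) u v = hamming-++ a b u v

hamming-++ˡ : (a : B m) (u v : B n) → hamming (a ++ u) (a ++ v) ≡ hamming u v
hamming-++ˡ a u v = trans (hamming-++ a a u v) (cong (_+ hamming u v) (hamming-refl a))

hamming-++ʳ : (a b : B m) (u : B n) → hamming (a ++ u) (b ++ u) ≡ hamming a b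
hamming-++ʳ a b u =
  trans (hamming-++ a b u u) (trans (cong (hamming a b +_) (hamming-refl u)) (+-identityʳ _))

-- Injections onto down-closed sets of vertices.

snoc : ∀ {G l u v w} → Walk G l u v → Adj G v w → Walk G (suc l) u w
snoc stop       b = step b stop
snoc (step a p) b = step a (snoc p b)

module DownClosedEmbedding
  (G : Graph) (m : ℕ) (f : Vertex G → B m)
  (f-injective : ∀ u v → f u ≡ f v → u ≡ v)
  (down-closed : ∀ u {x} → x ≤ᴮ f u → ∃[ v ] f v ≡ x)
  (adj⇒1 : ∀ {u v} → Adj G u v → hamming (f u) (f v) ≡ 1)
  (1⇒adj : ∀ {u v} → hamming (f u) (f v) ≡ 1 → Adj G u v)
  where

  hamming≤length : ∀ {l u v} → Walk G l u v → hamming (f u) (f v) ≤ l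
  hamming≤length {u = u} stop = ≤-reflexive (hamming-refl (f u))
  hamming≤length (step {l} {u} {v} {w} a p) = begin
    hamming (f u) (f w)                       ≤⟨ hamming-triangle (f u) (f v) (f w) ⟩
    hamming (f u) (f v) + hamming (f v) (f w) ≡⟨ cong (_+ hamming (f v) (f w)) (adj⇒1 a) ⟩
    suc (hamming (f v) (f w))                 ≤⟨ s≤s (hamming≤length p) ⟩
    suc l                                     ∎
    where open ≤-Reasoning

  -- The induction is over a subcube e of B m, initially the whole of it.
  subcube-walk : ∀ {j} (e : B j → B m) →
                 (∀ x y → hamming (e x) (e y) ≡ hamming x y) →
                 (∀ {x y} → x ≤ᴮ y → e x ≤ᴮ e y) →
                 ∀ x y {u v} → f u ≡ e x → f v ≡ e y → Walk G (hamming x y) u v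
  subcube-walk e iso mono [] [] {u} {v} p q
    with refl ← f-injective u v (trans p (sym q)) = stop
  subcube-walk e iso mono (true ∷ x) (true ∷ y) p q =
    subcube-walk (e ∘ (true ∷_)) (λ _ _ → iso _ _) (mono ∘ (b≤b ∷_)) x y p q
  subcube-walk e iso mono (false ∷ x) (false ∷ y) p q =
    subcube-walk (e ∘ (false ∷_)) (λ _ _ → iso _ _) (mono ∘ (b≤b ∷_)) x y p q
  subcube-walk e iso mono (true ∷ x) (false ∷ y) {u} {v} p q
    with w , r ← down-closed u (subst (e (false ∷ x) ≤ᴮ_) (sym p) (mono (f≤t ∷ ≤ᴮ-refl)))
    = step (1⇒adj (trans (cong₂ hamming p r) (trans (iso _ _) (cong suc (hamming-refl x)))))
           (subcube-walk (e ∘ (false ∷_)) (λ _ _ → iso _ _) (mono ∘ (b≤b ∷_)) x y r q)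
  -- A bit to be turned on is treated from the far end: turning it off in `f v` stays in the image,
  -- whereas turning it on in `f u` might leave it. The new edge therefore comes last.
  subcube-walk e iso mono (false ∷ x) (true ∷ y) {u} {v} p q
    with w , r ← down-closed v (subst (e (false ∷ y) ≤ᴮ_) (sym q) (mono (f≤t ∷ ≤ᴮ-refl)))
    = snoc (subcube-walk (e ∘ (false ∷_)) (λ _ _ → iso _ _) (mono ∘ (b≤b ∷_)) x y p r)
           (1⇒adj (trans (cong₂ hamming r q) (trans (iso _ _) (cong suc (hamming-refl y)))))

  isometric : IsIsometric G m f
  isometric u v =
    subcube-walk id (λ _ _ → refl) id (f u) (f v) refl refl , λ _ → hamming≤length

  properEmbedding : IsProperEmbedding G m f
  -- A down-closed set generates itself, so the whole image serves as the generating set.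
  properEmbedding = isometric , (λ x → ∃[ u ] f u ≡ x) ,
    ((λ {x} p → x , p , ≤ᴮ-refl) , below) ,
    (λ { {x} {y} (u , v , a , refl , refl) →
           (x , (u , refl) , ≤ᴮ-refl) , (y , (v , refl) , ≤ᴮ-refl) , adj⇒1 a }) ,
    λ (p , q , a) →
      let u , r = below p
          v , s = below q
      in u , v , 1⇒adj (trans (cong₂ hamming r s) a) , r , s
    where
    below : ∀ {x} → ∃[ y ] (∃[ u ] f u ≡ y) × x ≤ᴮ y → ∃[ u ] f u ≡ x
    below (_ , (u , refl) , x≤) = down-closed u x≤

-- The blocks `A i`: distances and order.

A-injective : (i j : Fin (suc k)) → A i ≡ A j → i ≡ j
A-injective zero          zero          _ = refl
A-injective zero          (suc zero)    ()
A-injective zero          (suc (suc j)) e = contradiction (A-injective zero (suc j) (∷-injectiveʳ e)) λ ()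
A-injective (suc zero)    zero          ()
A-injective (suc (suc i)) zero          e = contradiction (A-injective (suc i) zero (∷-injectiveʳ e)) λ ()
A-injective (suc zero)    (suc zero)    _ = refl
A-injective (suc zero)    (suc (suc j)) ()
A-injective (suc (suc i)) (suc zero)    ()
A-injective (suc (suc i)) (suc (suc j)) e = cong suc (A-injective (suc i) (suc j) (∷-injectiveʳ e))

hamming-A₀ : (i : Fin k) → hamming (A zero) (A (suc i)) ≡ 1
hamming-A₀ {suc k} zero = cong suc (hamming-refl (A {k} zero))
hamming-A₀ (suc i)      = hamming-A₀ i

-- Two strings with a single 1 each are at distance 0 or 2. This rules out edges between different
-- nonzero letters.
hamming-A-suc≢1 : (i j : Fin k) → hamming (A (suc i)) (A (suc j)) ≢ 1
hamming-A-suc≢1 {suc k} zero zero e =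
  contradiction (trans (sym (hamming-refl (A {k} zero))) e) λ ()
hamming-A-suc≢1 zero    (suc j) e = contradiction (trans (sym (hamming-A₀ j)) (suc-injective e)) λ ()
hamming-A-suc≢1 (suc i) zero    e =
  contradiction (trans (sym (trans (hamming-sym (A (suc i)) (A zero)) (hamming-A₀ i))) (suc-injective e)) λ ()
hamming-A-suc≢1 (suc i) (suc j) e = hamming-A-suc≢1 i j e

A₀-minimum : (x : B k) → A zero ≤ᴮ x
A₀-minimum []          = []
A₀-minimum (true  ∷ x) = f≤t ∷ A₀-minimum x
A₀-minimum (false ∷ x) = b≤b ∷ A₀-minimum x

-- `A i` has at most one bit on, and turning it off leaves `A zero`.
≤A⇒≡ : (i : Fin (suc k)) {x : B k} → x ≤ᴮ A i → x ≡ A zero ⊎ x ≡ A i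
≤A⇒≡ zero          x≤           = inj₁ (≤ᴮ-antisym x≤ (A₀-minimum _))
≤A⇒≡ (suc zero)    (f≤t ∷ x≤)   = inj₁ (cong (false ∷_) (≤ᴮ-antisym x≤ (A₀-minimum _)))
≤A⇒≡ (suc zero)    (b≤b ∷ x≤)   = inj₂ (cong (true ∷_) (≤ᴮ-antisym x≤ (A₀-minimum _)))
≤A⇒≡ (suc (suc i)) (b≤b ∷ x≤) with ≤A⇒≡ (suc i) x≤
... | inj₁ e = inj₁ (cong (false ∷_) e)
... | inj₂ e = inj₂ (cong (false ∷_) e)

A≤A⇒≡ : (i j : Fin (suc k)) → i ≢ zero → A i ≤ᴮ A j → i ≡ j
A≤A⇒≡ i j i≢0 Ai≤Aj with ≤A⇒≡ j Ai≤Aj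
... | inj₁ e = contradiction (A-injective i zero e) i≢0
... | inj₂ e = A-injective i j e

A-fromℕ≢A-inject₁ : (i : Fin k) → A (fromℕ k) ≢ A (inject₁ i)
A-fromℕ≢A-inject₁ i e = fromℕ≢inject₁ {i = i} (A-injective _ _ e)

-- Encodings of letter sequences.

-- The first block determines the first letter: the `A i` are pairwise distinct, and only `kk`
-- starts with `A (fromℕ k)`.
encode-injective : (ls ls′ : Letters k n) → encode ls ≡ encode ls′ → ls ≡ ls′
encode-injective []          []           _ = refl
encode-injective (char i ls) (char j ls′) e
  with p , q ← ++-injective (A (inject₁ i)) (A (inject₁ j)) e =
  cong₂ char (inject₁-injective (A-injective _ _ p)) (encode-injective ls ls′ q)
encode-injective {k} (char i ls) (kk ls′) e =
  contradiction (sym (++-injectiveˡ (A (inject₁ i)) (A (fromℕ k)) e)) (A-fromℕ≢A-inject₁ i)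
encode-injective {k} (kk ls) (char j ls′) e =
  contradiction (++-injectiveˡ (A (fromℕ k)) (A (inject₁ j)) e) (A-fromℕ≢A-inject₁ j)
encode-injective {k} (kk ls) (kk ls′) e =
  cong kk (encode-injective ls ls′
    (++-injectiveʳ (A zero) (A zero) (++-injectiveʳ (A (fromℕ k)) (A (fromℕ k)) e)))

-- Going down acts on each block separately: it either stays or drops to `A zero`, which is the
-- block of the letter 0.
encode-down-closed : (ls : Letters (suc k) n) {x : B (n * suc k)} →
                     x ≤ᴮ encode ls → Σ[ ls′ ∈ Letters (suc k) n ] encode ls′ ≡ x
encode-down-closed [] [] = [] , refl
encode-down-closed {k} (char i ls) {x} x≤ with Vec.splitAt (suc k) x
... | y , z , refl
  with ls′ , refl ← encode-down-closed ls (++ʳ⁻ y (A (inject₁ i)) x≤)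
  with ≤A⇒≡ (inject₁ i) (++ˡ⁻ y (A (inject₁ i)) x≤)
...   | inj₁ refl = char zero ls′ , refl
...   | inj₂ refl = char i ls′ , refl
encode-down-closed {k} (kk ls) {x} x≤ with Vec.splitAt (suc k) x
... | y , x′ , refl with Vec.splitAt (suc k) x′
...   | y′ , z , refl
  with x′≤ ← ++ʳ⁻ y (A (fromℕ (suc k))) x≤
  with ls′ , refl ← encode-down-closed ls (++ʳ⁻ y′ (A zero) x′≤)
  with refl ← ≤ᴮ-antisym (++ˡ⁻ y′ (A zero) x′≤) (A₀-minimum y′)
  with ≤A⇒≡ (fromℕ (suc k)) (++ˡ⁻ y (A (fromℕ (suc k))) x≤)
-- When `A (fromℕ (suc k))` drops, two zero blocks remain, so `kk` becomes `00`.
...     | inj₁ refl = char zero (char zero ls′) , refl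
...     | inj₂ refl = kk ls′ , refl

FStar⇒encode : {w : B (n * k)} → FStar k n w → Σ[ ls ∈ Letters k n ] encode ls ≡ w
FStar⇒encode []      = [] , refl
FStar⇒encode (A∷ i p) with ls , refl ← FStar⇒encode p = char i ls , refl
FStar⇒encode (AA∷ p)  with ls , refl ← FStar⇒encode p = kk ls , refl

-- Edges of the Munarini graph and Hamming distance 1.

-- Each replacement turns one block `A zero` into a nonzero `A i`; in `00↦kk` the second block stays
-- `A zero`. The spellings enter through equations, so that `v ⟶ w` can be matched together with the
-- letters.
⟶⇒hamming≡1 : (ls ls′ : Letters (suc k) n) {v w : Word (suc k) n} → v ⟶ w →
              spell ls ≡ v → spell ls′ ≡ w → hamming (encode ls) (encode ls′) ≡ 1
⟶⇒hamming≡1 (char zero ls) (char zero ls′) (0↦i zero () _) p q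
⟶⇒hamming≡1 (char zero ls) (char (suc j) ls′) (0↦i _ _ _) p q
  with refl ← spell-injective ls ls′ (trans (∷-injectiveʳ p) (sym (∷-injectiveʳ q))) =
  trans (hamming-++ʳ (A zero) (A (suc (inject₁ j))) (encode ls)) (hamming-A₀ (inject₁ j))
-- Here the new character would be `fromℕ (suc k)`, which the bound in `0↦i` excludes.
⟶⇒hamming≡1 {k} (char zero ls) (kk ls′) (0↦i _ _ i<k) p q =
  contradiction i<k (<-irrefl (trans (cong toℕ (sym (∷-injectiveˡ q))) (toℕ-fromℕ (suc k))))
⟶⇒hamming≡1 (char a ls) (char b ls′) 00↦kk p q =
  contradiction (sym (∷-injectiveˡ q)) fromℕ≢inject₁
⟶⇒hamming≡1 {k} (char zero (char zero ls)) (kk ls′) 00↦kk p q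
  with refl ← spell-injective ls ls′ (trans (∷-injectiveʳ (∷-injectiveʳ p)) (sym (∷-injectiveʳ (∷-injectiveʳ q)))) =
  trans (hamming-++ʳ (A zero) (A (suc (fromℕ k))) (A zero ++ encode ls)) (hamming-A₀ (fromℕ k))
⟶⇒hamming≡1 (char a ls) (char b ls′) (there c r) p q
  with refl ← inject₁-injective (trans (∷-injectiveˡ p) (sym (∷-injectiveˡ q))) =
  trans (hamming-++ˡ (A (inject₁ a)) (encode ls) (encode ls′))
        (⟶⇒hamming≡1 ls ls′ r (∷-injectiveʳ p) (∷-injectiveʳ q))
⟶⇒hamming≡1 (char a ls) (kk ls′) (there c r) p q =
  contradiction (trans (∷-injectiveˡ q) (sym (∷-injectiveˡ p))) fromℕ≢inject₁
⟶⇒hamming≡1 (kk ls) (char b ls′) (there c r) p q =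
  contradiction (trans (∷-injectiveˡ p) (sym (∷-injectiveˡ q))) fromℕ≢inject₁
-- A replacement cannot begin at the second half of `kk`, because that character is not 0.
⟶⇒hamming≡1 (kk ls) (kk ls′) (there c (0↦i _ _ _)) p q =
  contradiction (∷-injectiveˡ (∷-injectiveʳ p)) λ ()
⟶⇒hamming≡1 (kk ls) (kk ls′) (there c 00↦kk) p q =
  contradiction (∷-injectiveˡ (∷-injectiveʳ p)) λ ()
⟶⇒hamming≡1 {k} (kk ls) (kk ls′) (there c (there d r)) p q =
  trans (hamming-++ˡ (A (fromℕ (suc k))) (A zero ++ encode ls) (A zero ++ encode ls′))
    (trans (hamming-++ˡ (A {suc k} zero) (encode ls) (encode ls′))
      (⟶⇒hamming≡1 ls ls′ r (∷-injectiveʳ (∷-injectiveʳ p)) (∷-injectiveʳ (∷-injectiveʳ q))))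

adj⇒hamming≡1 : (ls ls′ : Letters (suc k) n) → SymClosure _⟶_ (spell ls) (spell ls′) →
                hamming (encode ls) (encode ls′) ≡ 1
adj⇒hamming≡1 ls ls′ (fwd r) = ⟶⇒hamming≡1 ls ls′ r refl refl
adj⇒hamming≡1 ls ls′ (bwd r) =
  trans (hamming-sym (encode ls) (encode ls′)) (⟶⇒hamming≡1 ls′ ls r refl refl)

-- Together with `hamming-++`: when two concatenations are at distance 1, one part agrees and the
-- other differs in one bit.
m+n≡1 : ∀ m {n} → m + n ≡ 1 → m ≡ 0 × n ≡ 1 ⊎ m ≡ 1 × n ≡ 0
m+n≡1 zero    e = inj₁ (refl , e)
m+n≡1 (suc m) e with refl ← m+n≡0⇒m≡0 m (suc-injective e) = inj₂ (refl , suc-injective e)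

0⟶inject₁ : {w : Word (suc k) n} (i : Fin k) → zero ∷ w ⟶ inject₁ (suc i) ∷ w
0⟶inject₁ i = 0↦i (inject₁ (suc i)) (s≤s z≤n) (inject₁ℕ< (suc i))

chars-adj : (i j : Fin (suc k)) {w : Word (suc k) n} →
            hamming (A (inject₁ i)) (A (inject₁ j)) ≡ 1 →
            SymClosure _⟶_ (inject₁ i ∷ w) (inject₁ j ∷ w)
chars-adj {k} zero    zero    e = contradiction (trans (sym (hamming-refl (A {suc k} zero))) e) λ ()
chars-adj     zero    (suc j) _ = fwd (0⟶inject₁ j)
chars-adj     (suc i) zero    _ = bwd (0⟶inject₁ i)
chars-adj     (suc i) (suc j) e = contradiction e (hamming-A-suc≢1 (inject₁ i) (inject₁ j))

there-adj : {v w : Word k n} (a : Fin (suc k)) →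
            SymClosure _⟶_ v w → SymClosure _⟶_ (a ∷ v) (a ∷ w)
there-adj a = Sym.gmap (a ∷_) (there a)

-- The first blocks differ, so they use up the whole distance and the rests agree. By injectivity
-- `ls` is then `char zero ls′`, and a block at distance 1 from `A (fromℕ (suc k))` can only be
-- `A zero`. The pair is thus `00` against `kk`.
char-kk-adj : (i : Fin (suc k)) (ls : Letters (suc k) (suc n)) (ls′ : Letters (suc k) n) →
              hamming (encode (char i ls)) (encode (kk ls′)) ≡ 1 →
              spell (char i ls) ⟶ spell (kk ls′)
char-kk-adj {k} i ls ls′ e
  with m+n≡1 (hamming (A (inject₁ i)) (A (fromℕ (suc k))))
         (trans (sym (hamming-++ (A (inject₁ i)) (A (fromℕ (suc k))) (encode ls) (A zero ++ encode ls′))) e)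
... | inj₁ (p , _) =
  contradiction (sym (hamming≡0⇒≡ (A (inject₁ i)) (A (fromℕ (suc k))) p)) (A-fromℕ≢A-inject₁ i)
... | inj₂ (p , q)
  with refl ← encode-injective ls (char zero ls′) (hamming≡0⇒≡ (encode ls) (A zero ++ encode ls′) q)
  with i
...   | zero   = 00↦kk
...   | suc i′ = contradiction p (hamming-A-suc≢1 (inject₁ i′) (fromℕ k))

hamming≡1⇒adj : (ls ls′ : Letters (suc k) n) → hamming (encode ls) (encode ls′) ≡ 1 →
                SymClosure _⟶_ (spell ls) (spell ls′)
hamming≡1⇒adj []          []           ()
hamming≡1⇒adj (char i ls) (char j ls′) e
  with m+n≡1 (hamming (A (inject₁ i)) (A (inject₁ j)))
         (trans (sym (hamming-++ (A (inject₁ i)) (A (inject₁ j)) (encode ls) (encode ls′))) e)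
... | inj₁ (p , q)
  with refl ← inject₁-injective (A-injective (inject₁ i) (inject₁ j) (hamming≡0⇒≡ (A (inject₁ i)) (A (inject₁ j)) p)) =
  there-adj (inject₁ i) (hamming≡1⇒adj ls ls′ q)
... | inj₂ (p , q)
  with refl ← encode-injective ls ls′ (hamming≡0⇒≡ (encode ls) (encode ls′) q) =
  chars-adj i j p
hamming≡1⇒adj (char i ls) (kk ls′) e = fwd (char-kk-adj i ls ls′ e)
hamming≡1⇒adj (kk ls) (char j ls′) e =
  bwd (char-kk-adj j ls′ ls (trans (hamming-sym (encode (char j ls′)) (encode (kk ls))) e))
hamming≡1⇒adj {k} (kk ls) (kk ls′) e =
  there-adj _ (there-adj _ (hamming≡1⇒adj ls ls′
    (trans (sym (trans (hamming-++ˡ (A (fromℕ (suc k))) (A zero ++ encode ls) (A zero ++ encode ls′))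
                       (hamming-++ˡ (A {suc k} zero) (encode ls) (encode ls′)))) e)))

-- Passing between letter sequences and Pell strings.

last-∷ : ∀ {a} {C : Set a} (x : C) xs {y} → List.last xs ≡ just y → List.last (x List.∷ xs) ≡ just y
last-∷ x (_ List.∷ _) e = e

-- Induction on the letters, removing the first one from the factorization. A `kk` lies entirely
-- before the run, inside it or after it, since any cut through its middle contradicts maximality of
-- the run.
spell-pell : (ls : Letters k n) → IsPell (spell ls)
spell-pell []          List.[]         zero    ys e p q = 2 ∣0
spell-pell (char i ls) List.[]         zero    ys e p q = 2 ∣0
spell-pell (char i ls) List.[]         (suc l) ys e p q =
  contradiction (sym (List.∷-injectiveˡ e)) fromℕ≢inject₁
spell-pell (char i ls) (x List.∷ xs)   l       ys e p q =
  spell-pell ls xs l ys (List.∷-injectiveʳ e) (p ∘ last-∷ x xs) q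
spell-pell (kk ls) List.[]             zero    ys e p q = 2 ∣0
-- The run would stop after the first half of `kk`, leaving `ys` to start with `fromℕ k`.
spell-pell (kk ls) List.[]             (suc zero) ys e p q =
  contradiction (cong List.head (sym (List.∷-injectiveʳ e))) q
spell-pell (kk ls) List.[]             (suc (suc l)) ys e p q =
  ∣m∣n⇒∣m+n ∣-refl
    (spell-pell ls List.[] l ys (List.∷-injectiveʳ (List.∷-injectiveʳ e)) (λ ()) q)
-- The run would start at the second half of `kk`, with `xs` ending in `fromℕ k`.
spell-pell (kk ls) (x List.∷ List.[])  l       ys e p q =
  contradiction (cong just (sym (List.∷-injectiveˡ e))) p
spell-pell (kk ls) (x List.∷ y List.∷ xs) l    ys e p q =
  spell-pell ls xs l ys (List.∷-injectiveʳ (List.∷-injectiveʳ e))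
    (p ∘ last-∷ x (y List.∷ xs) ∘ last-∷ y xs) q

letters : Pell n k → Letters k n
letters u = proj₁ (decompose u)

spell-letters : (u : Pell n k) → spell (letters u) ≡ value u
spell-letters u = proj₂ (decompose u)

toPell : Letters k n → Pell n k
toPell ls = spell ls , [ spell-pell ls ]

-- `decompose` does not reduce on a variable `ls`; its equation and uniqueness of the factorization
-- identify the result.
letters-toPell : (ls : Letters k n) → letters (toPell ls) ≡ ls
letters-toPell ls = spell-injective _ ls (spell-letters (toPell ls))

-- Covers every positive parameter, so it yields both the daisy cube claim and the embedding claim.
-- The facts about letters are carried to Pell strings along `spell-letters`.
Ψ̂-properEmbedding : (n k : ℕ) → IsProperEmbedding (M n (suc k)) (n * suc k) (value ∘ Ψ̂ n (suc k))
Ψ̂-properEmbedding n k =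
  DownClosedEmbedding.properEmbedding (M n (suc k)) (n * suc k) (value ∘ Ψ̂ n (suc k))
    (λ u v e → value-injective
      (trans (sym (spell-letters u))
        (trans (cong spell (encode-injective (letters u) (letters v) e)) (spell-letters v))))
    (λ u x≤ → let ls , e = encode-down-closed (letters u) x≤
              in toPell ls , trans (cong encode (letters-toPell ls)) e)
    (λ {u} {v} a → adj⇒hamming≡1 (letters u) (letters v)
      (subst₂ (SymClosure _⟶_) (sym (spell-letters u)) (sym (spell-letters v)) a))
    (λ {u} {v} e → subst₂ (SymClosure _⟶_) (spell-letters u) (spell-letters v)
      (hamming≡1⇒adj (letters u) (letters v) e))

-- Generators and maximal vertices.

-- Supplies a generator above any encoded string. The form `2 + k` guarantees that 1 is a letter
-- different from the character that occurs in pairs.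
fill : Letters (2 + k) n → Letters (2 + k) n
fill []                = []
fill (char zero ls)    = char (suc zero) (fill ls)
fill (char (suc i) ls) = char (suc i) (fill ls)
fill (kk ls)           = kk (fill ls)

zero∉fill : (ls : Letters (2 + k) n) → zero ∉ spell (fill ls)
zero∉fill []                ()
zero∉fill (char zero ls)    (there p)         = zero∉fill ls p
zero∉fill (char (suc i) ls) (there p)         = zero∉fill ls p
zero∉fill (kk ls)           (there (there p)) = zero∉fill ls p

encode≤fill : (ls : Letters (2 + k) n) → encode ls ≤ᴮ encode (fill ls)
encode≤fill []                = []
encode≤fill (char zero ls)    = ++⁺ (A₀-minimum (A (suc zero))) (encode≤fill ls)
encode≤fill (char (suc i) ls) = ++⁺ (≤ᴮ-refl {u = A (suc (inject₁ i))}) (encode≤fill ls)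
encode≤fill {k} (kk ls)       =
  ++⁺ (≤ᴮ-refl {u = A (fromℕ (2 + k))}) (++⁺ (≤ᴮ-refl {u = A zero}) (encode≤fill ls))

-- Without the letter 0, the leading block of each letter is nonzero, and a nonzero `A i` lies only
-- below itself among the blocks. Hence the letters of both sequences match one by one.
encode-noZero-maximal : (ls ls′ : Letters (suc k) n) → zero ∉ spell ls →
                        encode ls ≤ᴮ encode ls′ → ls ≡ ls′
encode-noZero-maximal []          []           _  _  = refl
encode-noZero-maximal (char i ls) (char j ls′) ls∌0 ls≤ls′ =
  cong₂ char
    (inject₁-injective (A≤A⇒≡ (inject₁ i) _ (λ e → ls∌0 (here (sym e))) (++ˡ⁻ (A (inject₁ i)) (A (inject₁ j)) ls≤ls′)))
    (encode-noZero-maximal ls ls′ (λ p → ls∌0 (there p)) (++ʳ⁻ (A (inject₁ i)) (A (inject₁ j)) ls≤ls′))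
encode-noZero-maximal {k} (char i ls) (kk ls′) ls∌0 ls≤ls′ =
  contradiction
    (sym (A≤A⇒≡ (inject₁ i) _ (λ e → ls∌0 (here (sym e))) (++ˡ⁻ (A (inject₁ i)) (A (fromℕ (suc k))) ls≤ls′)))
    fromℕ≢inject₁
encode-noZero-maximal {k} (kk ls) (char j ls′) ls∌0 ls≤ls′ =
  contradiction
    (A≤A⇒≡ (fromℕ (suc k)) (inject₁ j) (λ ()) (++ˡ⁻ (A (fromℕ (suc k))) (A (inject₁ j)) ls≤ls′))
    fromℕ≢inject₁
encode-noZero-maximal {k} (kk ls) (kk ls′) ls∌0 ls≤ls′ =
  cong kk (encode-noZero-maximal ls ls′ (λ p → ls∌0 (there (there p)))
    (++ʳ⁻ (A zero) (A zero) (++ʳ⁻ (A (fromℕ (suc k))) (A (fromℕ (suc k))) ls≤ls′)))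

Γ⋆≈daisyCube : (n k : ℕ) → Γ⋆ n (2 + k) ≈ₛ daisyCube (X n (2 + k))
Γ⋆≈daisyCube n k = (to , from) ,
  -- Both subgraphs are induced, so their edges agree once their vertices do.
  (λ (p , q , a) → to p , to q , a) , (λ (p , q , a) → from p , from q , a)
  where
  to : ∀ {w} → FStar (2 + k) n w → ∃[ x ] X n (2 + k) x × w ≤ᴮ x
  to p with ls , refl ← FStar⇒encode p =
    encode (fill ls) ,
    (toPell (fill ls) , zero∉fill ls , cong encode (letters-toPell (fill ls))) ,
    encode≤fill ls
  from : ∀ {w} → ∃[ x ] X n (2 + k) x × w ≤ᴮ x → FStar (2 + k) n w
  from (_ , (u , _ , refl) , w≤) with ls , refl ← encode-down-closed (letters u) w≤ =
    encode-FStar ls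

-- By `encode-noZero-maximal` the set `X` is an antichain, so all its elements are maximal in it.
X-maximal : (n k : ℕ) → MaximalVertex (X n (suc k)) ≐ X n (suc k)
X-maximal n k = proj₁ , λ Xx → Xx , max Xx
  where
  max : ∀ {x} → X n (suc k) x → ∀ {y} → X n (suc k) y → x ≤ᴮ y → y ≡ x
  max (u , u∌0 , refl) (v , _ , refl) x≤y =
    cong encode (sym (encode-noZero-maximal (letters u) (letters v)
      (subst (zero ∉_) (sym (spell-letters u)) u∌0) x≤y))

theorem3p3 : (n k : ℕ) .{{_ : NonZero n}} .{{_ : NonZero k}} →
    IsDaisyCube (M n k) ×
    (2 ≤ k →
    IsProperEmbedding (M n k) (n * k) (value ∘ Ψ̂ n k) ×
    (Γ⋆ n k ≈ₛ daisyCube (X n k)) ×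
    (MaximalVertex (X n k) ≐ X n k))
theorem3p3 n (suc k) = (n * suc k , value ∘ Ψ̂ n (suc k) , Ψ̂-properEmbedding n k) , λ where
  -- The match exposes the parameter as `2 + k′`, the form that `fill` requires.
  (s≤s (s≤s {n = k′} _)) → Ψ̂-properEmbedding n k , Γ⋆≈daisyCube n k′ , X-maximal n k
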